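{- Let $G_1$ and $G_2$ be two disjoint $(k+1)$-critical hypergraphs with $k\ge2$, let $\tilde e\in E(G_1)$ be an ordinary edge (i.e. $|\tilde e|=2$), let $\tilde v\in V(G_2)$ be arbitrary, and let $s$ be an admissible map for $(\tilde e,G_2,\tilde v)$. Let $G=S(G_1,\tilde e,G_2,\tilde v,s)$ and $G_2'=G[(V(G_2)\setminus\{\tilde v\})\cup\tilde e]$. If $\chi(G_2')\le k$, then $G$ is $(k+1)$-critical and $\tilde e$ is a separating vertex set of $G$ of size $2$.
   Context: A hypergraph is a pair $G=(V,E)$ of finite sets with $E\subseteq 2^V$ and $|e|\ge2$ for all $e\in E$. A coloring requires every edge to contain two vertices of different colors; $\chi$ is the chromatic number. $G$ is $(k+1)$-critical if $\chi(G)=k+1$ but $\chi(H)\le k$ for every proper subhypergraph $H$. $G[X]$ has vertex set $X$ and the edges of $G$ contained in $X$. $\partial_G(v)$ is the set of edges containing $v$. A set $S\subseteq V(G)$ is a separating vertex set if $G$ is the union of two induced subhypergraphs $G_1,G_2$ with $V(G_1)\cap V(G_2)=S$ and $|V(G_i)|>|S|$. Splitting: let $G_1,G_2$ be disjoint hypergraphs, $\tilde e\in E(G_1)$, $\tilde v\in V(G_2)$, and $s:\partial_{G_2}(\tilde v)\to 2^{\tilde e}$ a map (called admissible) with $s(e)\ne\varnothing$ for all $e$ and $\bigcup_{e}s(e)=\tilde e$. Then $S(G_1,\tilde e,G_2,\tilde v,s)$ is the hypergraph with vertex set $V(G_1)\cup(V(G_2)\setminus\{\tilde v\})$ and edge set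 $(E(G_1)\setminus\{\tilde e\})\cup(E(G_2)\setminus\partial_{G_2}(\tilde v))\cup\{(e\setminus\{\tilde v\})\cup s(e): e\in\partial_{G_2}(\tilde v)\}$. -}

module Defs where

open import Data.Bool.Properties using () renaming (_≟_ to _≟ᵇ_)
open import Data.Empty using (⊥-elim)
open import Data.Fin using (Fin; toℕ; fromℕ<) renaming (zero to fzero; suc to fsuc)
open import Data.Fin.Properties using (any?; all?; toℕ<n; toℕ-fromℕ<; toℕ-injective)
  renaming (_≟_ to _≟ᶠ_)
open import Data.Fin.Subset
  using (Subset; _∈_; _⊆_; _∩_; _∪_; _-_; ∣_∣; Nonempty; Empty; ⁅_⁆)
open import Data.Fin.Subset.Properties
open import Data.Nat using (ℕ; zero; suc; _≤_; _<_; _≥_; _>_; _⊓_; z≤n; s≤s; _<?_)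
open import Data.Nat.Properties
  using (≤-trans; ≤-reflexive; <⇒≤; <⇒≱; m≤n⇒m⊓n≡m; m⊓n≤n)
  renaming (_≟_ to _≟ⁿ_)
open import Data.Product using (Σ-syntax; ∃; ∃-syntax; ∃₂; _×_; _,_; proj₁; proj₂)
open import Data.Sum using (_⊎_; inj₁; inj₂; [_,_]′)
open import Data.Vec using (Vec; []; _∷_; lookup; tabulate; there)
open import Data.Vec.Properties using (≡-dec; lookup∘tabulate)
open import Function using (_∘_)
open import Level using (0ℓ)
open import Relation.Binary.PropositionalEquality
  using (_≡_; _≢_; refl; sym; trans; cong; subst; subst₂)
open import Relation.Nullary using (Dec; yes; no; ¬_)
open import Relation.Nullary.Decidable
  using (map′; _×-dec_; _⊎-dec_; _→-dec_; ¬?; decidable-stable)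
open import Relation.Unary using (Pred; Decidable)

private variable
  n : ℕ

_≟ˢ_ : (p q : Subset n) → Dec (p ≡ q)
_≟ˢ_ = ≡-dec _≟ᵇ_

nonempty⇒∣p∣≥1 : {p : Subset n} → Nonempty p → ∣ p ∣ ≥ 1
nonempty⇒∣p∣≥1 (_ , x∈p) = ≤-trans (s≤s z≤n) (x∈p⇒∣p-x∣<∣p∣ x∈p)

distinct⇒∣p∣≥2 : {p : Subset n} {x y : Fin n} → x ∈ p → y ∈ p → x ≢ y → ∣ p ∣ ≥ 2
distinct⇒∣p∣≥2 x∈p y∈p x≢y =
  ≤-trans (s≤s (nonempty⇒∣p∣≥1 (_ , x∈p∧x≢y⇒x∈p-y x∈p x≢y))) (x∈p⇒∣p-x∣<∣p∣ y∈p)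

∣p∣≥2⇒other : {p : Subset n} → ∣ p ∣ ≥ 2 → (v : Fin n) → ∃[ x ] x ∈ p × x ≢ v
∣p∣≥2⇒other {p = p} 2≤∣p∣ v with any? (λ x → (x ∈? p) ×-dec ¬? (x ≟ᶠ v))
... | yes other = other
... | no none = ⊥-elim (<⇒≱ 2≤∣p∣
        (≤-trans (p⊆q⇒∣p∣≤∣q∣ p⊆⁅v⁆) (≤-reflexive (∣⁅x⁆∣≡1 v))))
  where
  p⊆⁅v⁆ : p ⊆ ⁅ v ⁆
  p⊆⁅v⁆ {x} x∈p with x ≟ᶠ v
  ... | yes refl = x∈⁅x⁆ v
  ... | no x≢v  = ⊥-elim (none (x , x∈p , x≢v))

∣p∣≥2⇒distinct : {p : Subset n} → ∣ p ∣ ≥ 2 → ∃₂ λ x y → x ∈ p × y ∈ p × x ≢ y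
∣p∣≥2⇒distinct {n} {p} 2≤∣p∣ with nonempty? p
... | no empty = ⊥-elim (<⇒≱ 2≤∣p∣ (≤-trans (≤-reflexive
        (trans (cong ∣_∣ (Empty-unique empty)) (∣⊥∣≡0 n))) z≤n))
... | yes (y , y∈p) with ∣p∣≥2⇒other 2≤∣p∣ y
...   | x , x∈p , x≢y = x , y , x∈p , y∈p , x≢y

y∈p-x⇒y≢x : (p : Subset n) {x y : Fin n} → y ∈ p - x → y ≢ x
y∈p-x⇒y≢x (_ ∷ p) {fzero}  () refl
y∈p-x⇒y≢x (_ ∷ p) {fsuc x} (there x∈p-x) refl = y∈p-x⇒y≢x p x∈p-x refl

-- A finite vertex set is a subset of an ambient `Fin n`, so that unions,
-- disjointness and equality of hypergraphs are those of sets.  Edges form a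
-- decidable predicate on subsets, i.e. a finite set of subsets.

record Hypergraph (n : ℕ) : Set₁ where
  field
    V      : Subset n
    E      : Pred (Subset n) 0ℓ
    E?     : Decidable E
    E⊆V    : ∀ {e} → E e → e ⊆ V
    ∣E∣≥2  : ∀ {e} → E e → ∣ e ∣ ≥ 2

open Hypergraph public

∂ : Hypergraph n → Fin n → Pred (Subset n) 0ℓ
∂ G v e = E G e × v ∈ e

infix 4 _⊑_ _≋_ _⊏_

_⊑_ : Hypergraph n → Hypergraph n → Set
H ⊑ G = (V H ⊆ V G) × (∀ {e} → E H e → E G e)

_≋_ : Hypergraph n → Hypergraph n → Set
H ≋ G = H ⊑ G × G ⊑ H

_⊏_ : Hypergraph n → Hypergraph n → Set
H ⊏ G = H ⊑ G × ¬ (H ≋ G)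

infix 8 _[_]

_[_] : Hypergraph n → Subset n → Hypergraph n
G [ X ] = record
  { V     = X
  ; E     = λ e → E G e × e ⊆ X
  ; E?    = λ e → E? G e ×-dec (e ⊆? X)
  ; E⊆V   = proj₂
  ; ∣E∣≥2 = ∣E∣≥2 G ∘ proj₁
  }

infixr 6 _⊔ᴴ_

_⊔ᴴ_ : Hypergraph n → Hypergraph n → Hypergraph n
G₁ ⊔ᴴ G₂ = record
  { V     = V G₁ ∪ V G₂
  ; E     = λ e → E G₁ e ⊎ E G₂ e
  ; E?    = λ e → E? G₁ e ⊎-dec E? G₂ e
  ; E⊆V   = [ (λ e∈ → p⊆p∪q (V G₂) ∘ E⊆V G₁ e∈) , (λ e∈ → q⊆p∪q (V G₁) (V G₂) ∘ E⊆V G₂ e∈) ]′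
  ; ∣E∣≥2 = [ ∣E∣≥2 G₁ , ∣E∣≥2 G₂ ]′
  }

-- Colors are 0, …, k − 1; the values of φ outside V G are irrelevant.

IsColoring : Hypergraph n → ℕ → (Fin n → ℕ) → Set
IsColoring G k φ =
  (∀ x → x ∈ V G → φ x < k) ×
  (∀ e → E G e → ∃₂ λ x y → x ∈ e × y ∈ e × φ x ≢ φ y)

Colorable : Hypergraph n → ℕ → Set
Colorable {n} G k = Σ[ φ ∈ (Fin n → ℕ) ] IsColoring G k φ

isColoring? : (G : Hypergraph n) (k : ℕ) (φ : Fin n → ℕ) → Dec (IsColoring G k φ)
isColoring? G k φ =
  all? (λ x → (x ∈? V G) →-dec (φ x <? k)) ×-dec allEdges
  where
  Bichromatic : Subset _ → Set
  Bichromatic e = ∃₂ λ x y → x ∈ e × y ∈ e × φ x ≢ φ y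

  bichromatic? : Decidable Bichromatic
  bichromatic? e = any? λ x → any? λ y →
    (x ∈? e) ×-dec ((y ∈? e) ×-dec ¬? (φ x ≟ⁿ φ y))

  allEdges : Dec (∀ e → E G e → Bichromatic e)
  allEdges = map′
    (λ none e e∈ → decidable-stable (bichromatic? e) (λ ¬b → none (e , e∈ , ¬b)))
    (λ all (e , e∈ , ¬b) → ¬b (all e e∈))
    (¬? (anySubset? (λ e → E? G e ×-dec ¬? (bichromatic? e))))

anyVec? : ∀ {m} n {P : Pred (Vec (Fin m) n) 0ℓ} → Decidable P → Dec (∃ P)
anyVec? zero    P? = map′ ([] ,_) (λ { ([] , p) → p }) (P? [])
anyVec? (suc n) P? = map′
  (λ (i , v , p) → i ∷ v , p) (λ { (i ∷ v , p) → i , v , p })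
  (any? λ i → anyVec? n λ v → P? (i ∷ v))

isColoring-resp : (G : Hypergraph n) {k : ℕ} {φ ψ : Fin n → ℕ} →
  (∀ x → x ∈ V G → φ x ≡ ψ x) → IsColoring G k φ → IsColoring G k ψ
isColoring-resp G {k} φ≡ψ (bound , proper) =
  (λ x x∈V → subst (_< k) (φ≡ψ x x∈V) (bound x x∈V)) ,
  λ e e∈ → let x , y , x∈e , y∈e , φx≢φy = proper e e∈ in
    x , y , x∈e , y∈e ,
    subst₂ _≢_ (φ≡ψ x (E⊆V G e∈ x∈e)) (φ≡ψ y (E⊆V G e∈ y∈e)) φx≢φy

colorable? : (G : Hypergraph n) → Decidable (Colorable G)
colorable? {n} G k = map′ (λ (v , c) → toℕ ∘ lookup v , c) bounded
  (anyVec? {suc k} n (λ v → isColoring? G k (toℕ ∘ lookup v)))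
  where
  bounded : Colorable G k → Σ[ v ∈ Vec (Fin (suc k)) n ] IsColoring G k (toℕ ∘ lookup v)
  bounded (φ , c) = tabulate ψ , isColoring-resp G φ≡ψ c
    where
    ψ : Fin n → Fin (suc k)
    ψ x = fromℕ< (s≤s (m⊓n≤n (φ x) k))

    φ≡ψ : ∀ x → x ∈ V G → φ x ≡ toℕ (lookup (tabulate ψ) x)
    φ≡ψ x x∈V = sym (trans (cong toℕ (lookup∘tabulate ψ x))
      (trans (toℕ-fromℕ< _) (m≤n⇒m⊓n≡m (<⇒≤ (proj₁ c x x∈V)))))

colorable-n : (G : Hypergraph n) → Colorable G n
colorable-n G = toℕ , (λ x _ → toℕ<n x) , λ e e∈ →
  let x , y , x∈e , y∈e , x≢y = ∣p∣≥2⇒distinct (∣E∣≥2 G e∈) in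
  x , y , x∈e , y∈e , x≢y ∘ toℕ-injective

least : {P : Pred ℕ 0ℓ} → Decidable P → ∀ m → P m →
        ∃[ l ] P l × (∀ j → P j → l ≤ j)
least P? m pm with P? 0
least P? m       pm | yes p₀ = 0 , p₀ , λ _ _ → z≤n
least P? zero    pm | no ¬p₀ = ⊥-elim (¬p₀ pm)
least P? (suc m) pm | no ¬p₀ with least (P? ∘ suc) m pm
... | l , pl , min = suc l , pl , λ where
  zero    p₀ → ⊥-elim (¬p₀ p₀)
  (suc j) pj → s≤s (min j pj)

chromatic : (G : Hypergraph n) →
            ∃[ m ] Colorable G m × (∀ j → Colorable G j → m ≤ j)
chromatic {n} G = least (colorable? G) n (colorable-n G)

χ : Hypergraph n → ℕ
χ G = proj₁ (chromatic G)

Critical : ℕ → Hypergraph n → Set₁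
Critical {n} m G = χ G ≡ m × ((H : Hypergraph n) → H ⊏ G → χ H < m)

SeparatingVertexSet : Hypergraph n → Subset n → Set
SeparatingVertexSet G S =
  S ⊆ V G ×
  ∃₂ λ X₁ X₂ →
    X₁ ⊆ V G × X₂ ⊆ V G ×
    G ≋ G [ X₁ ] ⊔ᴴ G [ X₂ ] ×
    X₁ ∩ X₂ ≡ S ×
    ∣ X₁ ∣ > ∣ S ∣ × ∣ X₂ ∣ > ∣ S ∣

Disjoint : Hypergraph n → Hypergraph n → Set
Disjoint G₁ G₂ = Empty (V G₁ ∩ V G₂)

-- A map s : ∂ G₂ ṽ → 2^ẽ is given by any extension to all subsets; only its
-- values on ∂ G₂ ṽ are ever used.

record Admissible (ẽ : Subset n) (G₂ : Hypergraph n) (ṽ : Fin n)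
                  (s : Subset n → Subset n) : Set where
  field
    into     : ∀ {e} → ∂ G₂ ṽ e → s e ⊆ ẽ
    nonempty : ∀ {e} → ∂ G₂ ṽ e → Nonempty (s e)
    covers   : ∀ {x} → x ∈ ẽ → ∃[ e ] ∂ G₂ ṽ e × x ∈ s e

-- The proof arguments are only needed to see that the result is a hypergraph.

splitting : (G₁ : Hypergraph n) (ẽ : Subset n) (G₂ : Hypergraph n) (ṽ : Fin n)
            (s : Subset n → Subset n) →
            Disjoint G₁ G₂ → E G₁ ẽ → Admissible ẽ G₂ ṽ s → Hypergraph n
splitting {n} G₁ ẽ G₂ ṽ s disjoint ẽ∈E₁ adm = record
  { V     = V′
  ; E     = E′
  ; E?    = λ f →
      (E? G₁ f ×-dec ¬? (f ≟ˢ ẽ)) ⊎-dec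
      (E? G₂ f ×-dec ¬? (E? G₂ f ×-dec (ṽ ∈? f))) ⊎-dec
      anySubset? (λ e → (E? G₂ e ×-dec (ṽ ∈? e)) ×-dec (f ≟ˢ ((e - ṽ) ∪ s e)))
  ; E⊆V   = E′⊆V′
  ; ∣E∣≥2 = ∣E′∣≥2
  }
  where
  open Admissible adm

  V′ : Subset n
  V′ = V G₁ ∪ (V G₂ - ṽ)

  E′ : Pred (Subset n) 0ℓ
  E′ f = (E G₁ f × f ≢ ẽ)
       ⊎ (E G₂ f × ¬ ∂ G₂ ṽ f)
       ⊎ (∃[ e ] ∂ G₂ ṽ e × f ≡ (e - ṽ) ∪ s e)

  left : V G₁ ⊆ V′
  left = p⊆p∪q (V G₂ - ṽ)

  right : ∀ {x} → x ∈ V G₂ → x ≢ ṽ → x ∈ V′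
  right x∈V₂ x≢ṽ = q⊆p∪q (V G₁) (V G₂ - ṽ) (x∈p∧x≢y⇒x∈p-y x∈V₂ x≢ṽ)

  E′⊆V′ : ∀ {f} → E′ f → f ⊆ V′
  E′⊆V′ (inj₁ (f∈ , _)) x∈f = left (E⊆V G₁ f∈ x∈f)
  E′⊆V′ (inj₂ (inj₁ (f∈ , f∉∂))) x∈f =
    right (E⊆V G₂ f∈ x∈f) λ { refl → f∉∂ (f∈ , x∈f) }
  E′⊆V′ (inj₂ (inj₂ (e , e∈∂ , refl))) x∈f with x∈p∪q⁻ (e - ṽ) (s e) x∈f
  ... | inj₁ x∈e-ṽ = right (E⊆V G₂ (proj₁ e∈∂) (p─q⊆p e ⁅ ṽ ⁆ x∈e-ṽ)) (y∈p-x⇒y≢x e x∈e-ṽ)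
  ... | inj₂ x∈se  = left (E⊆V G₁ ẽ∈E₁ (into e∈∂ x∈se))

  ∣E′∣≥2 : ∀ {f} → E′ f → ∣ f ∣ ≥ 2
  ∣E′∣≥2 (inj₁ (f∈ , _)) = ∣E∣≥2 G₁ f∈
  ∣E′∣≥2 (inj₂ (inj₁ (f∈ , _))) = ∣E∣≥2 G₂ f∈
  ∣E′∣≥2 (inj₂ (inj₂ (e , e∈∂ , refl))) =
    let x , x∈e , x≢ṽ = ∣p∣≥2⇒other (∣E∣≥2 G₂ (proj₁ e∈∂)) ṽ
        y , y∈se      = nonempty e∈∂
        y∈V₁          = E⊆V G₁ ẽ∈E₁ (into e∈∂ y∈se)
    in distinct⇒∣p∣≥2
         (p⊆p∪q (s e) (x∈p∧x≢y⇒x∈p-y x∈e x≢ṽ))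
         (q⊆p∪q (e - ṽ) (s e) y∈se)
         (λ x≡y → disjoint
           (x , x∈p∩q⁺ (subst (_∈ V G₁) (sym x≡y) y∈V₁ , E⊆V G₂ (proj₁ e∈∂) x∈e)))

-- In a k-coloring of G₁ without ẽ, the ends of ẽ have the same color, so a
-- k-coloring of G would contract (ẽ to ṽ) to one of G₂.  Conversely, deleting
-- an edge coming from G₂ leaves k-colorings of G₁ − ẽ and of G₂ − f that can be
-- glued by matching the colors of ẽ and ṽ.  Deleting an edge f ≠ ẽ of G₁
-- leaves a coloring of G₁ − f that distinguishes the ends of ẽ; so does any
-- k-coloring of G₂′, which exists by assumption, and since ∣ẽ∣ = 2 a
-- permutation of the colors makes the two agree on ẽ.

module Submission where

open import Defs
open import Data.Empty using (⊥-elim)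
open import Data.Fin using (Fin)
open import Data.Fin.Properties using (any?) renaming (_≟_ to _≟ᶠ_)
open import Data.Fin.Subset using (Subset; _∈_; _∉_; _⊆_; _∩_; _∪_; _-_; ∣_∣; ⁅_⁆)
open import Data.Fin.Subset.Properties
open import Data.Nat using (ℕ; suc; _≤_; _<_; z≤n; s≤s)
open import Data.Nat.Properties
  using (≤-trans; ≤-reflexive; ≤-antisym; <-≤-trans; <⇒≱; ≰⇒>; <⇒≢; n<1+n; 0≢1+n; m<n⇒m<1+n)
  renaming (_≟_ to _≟ⁿ_)
open import Data.Product using (∃; ∃-syntax; ∃₂; _×_; _,_; proj₁; proj₂)
open import Data.Sum using (_⊎_; inj₁; inj₂; [_,_]′)
open import Data.Vec.Functional using (updateAt)
open import Data.Vec.Functional.Properties using (updateAt-updates; updateAt-minimal)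
open import Function using (_∘_; const)
open import Function.Definitions using (Injective)
open import Relation.Binary.PropositionalEquality
  using (_≡_; _≢_; refl; sym; trans; cong; subst)
open import Relation.Nullary using (yes; no; ¬_)
open import Relation.Nullary.Decidable using (_×-dec_; ¬?; decidable-stable)

private variable
  n j k : ℕ
  G H : Hypergraph n
  e f : Subset n
  φ ψ : Fin n → ℕ

-- Finite subsets

x∉p-x : (p : Subset n) {x : Fin n} → x ∉ p - x
x∉p-x p x∈p-x = y∈p-x⇒y≢x p x∈p-x refl

-- A third element `z` could be removed and would still leave the distinct elements `x` and `y`.
∣p∣≡2⇒pair : {p : Subset n} {x y z : Fin n} → ∣ p ∣ ≡ 2 →
             x ∈ p → y ∈ p → x ≢ y → z ∈ p → z ≡ x ⊎ z ≡ y
∣p∣≡2⇒pair {x = x} {y} {z} ∣p∣≡2 x∈p y∈p x≢y z∈p with z ≟ᶠ x | z ≟ᶠ y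
... | yes z≡x | _       = inj₁ z≡x
... | no _    | yes z≡y = inj₂ z≡y
... | no z≢x  | no z≢y  = ⊥-elim (<⇒≱ 3≤∣p∣ (≤-reflexive ∣p∣≡2))
  where
  3≤∣p∣ = <-≤-trans
    (s≤s (distinct⇒∣p∣≥2 (x∈p∧x≢y⇒x∈p-y x∈p (z≢x ∘ sym)) (x∈p∧x≢y⇒x∈p-y y∈p (z≢y ∘ sym)) x≢y))
    (x∈p⇒∣p-x∣<∣p∣ z∈p)

-- Colorings

Bichromatic : (Fin n → ℕ) → Subset n → Set
Bichromatic φ e = ∃₂ λ x y → x ∈ e × y ∈ e × φ x ≢ φ y

-- Each vertex may be traded for another of the same color. This is what contracting `ẽ` to `ṽ`, and
-- undoing it, do to an edge.
bichromatic-map : (∀ {x} → x ∈ e → ∃[ y ] y ∈ f × φ x ≡ ψ y) →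
                  Bichromatic φ e → Bichromatic ψ f
bichromatic-map h (x , y , x∈e , y∈e , φx≢φy) =
  let x′ , x′∈f , φx≡ψx′ = h x∈e
      y′ , y′∈f , φy≡ψy′ = h y∈e
  in x′ , y′ , x′∈f , y′∈f ,
     λ ψx′≡ψy′ → φx≢φy (trans φx≡ψx′ (trans ψx′≡ψy′ (sym φy≡ψy′)))

bichromatic-resp : (∀ {x} → x ∈ e → φ x ≡ ψ x) → Bichromatic φ e → Bichromatic ψ e
bichromatic-resp φ≡ψ = bichromatic-map λ x∈e → _ , x∈e , φ≡ψ x∈e

isColoring-⊑ : H ⊑ G → IsColoring G k φ → IsColoring H k φ
isColoring-⊑ (V⊆ , E⊆) (bound , proper) = (λ x → bound x ∘ V⊆) , (λ e → proper e ∘ E⊆)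

colorable-mono : j ≤ k → Colorable G j → Colorable G k
colorable-mono j≤k (φ , bound , proper) =
  φ , (λ x x∈V → <-≤-trans (bound x x∈V) j≤k) , proper

χ≤⇒colorable : (G : Hypergraph n) → χ G ≤ k → Colorable G k
χ≤⇒colorable G χ≤k = colorable-mono {G = G} χ≤k (proj₁ (proj₂ (chromatic G)))

colorable⇒χ≤ : (G : Hypergraph n) → Colorable G k → χ G ≤ k
colorable⇒χ≤ G = proj₂ (proj₂ (chromatic G)) _

-- Permutations of colors

transposition : ℕ → ℕ → ℕ → ℕ
transposition c d x with x ≟ⁿ c | x ≟ⁿ d
... | yes _ | _     = d
... | no _  | yes _ = c
... | no _  | no _  = x

transposition-left : ∀ c d → transposition c d c ≡ d
transposition-left c d with c ≟ⁿ c | c ≟ⁿ d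
... | yes _  | _ = refl
... | no c≢c | _ = ⊥-elim (c≢c refl)

transposition-other : ∀ {c d x} → x ≢ c → x ≢ d → transposition c d x ≡ x
transposition-other {c} {d} {x} x≢c x≢d with x ≟ⁿ c | x ≟ⁿ d
... | yes x≡c | _       = ⊥-elim (x≢c x≡c)
... | no _    | yes x≡d = ⊥-elim (x≢d x≡d)
... | no _    | no _    = refl

transposition-injective : ∀ c d → Injective _≡_ _≡_ (transposition c d)
transposition-injective c d {x} {y} eq with x ≟ⁿ c | x ≟ⁿ d | y ≟ⁿ c | y ≟ⁿ d
... | yes x≡c | _       | yes y≡c | _       = trans x≡c (sym y≡c)
... | yes x≡c | _       | no _    | yes y≡d = trans x≡c (trans (sym eq) (sym y≡d))
... | yes _   | _       | no _    | no y≢d  = ⊥-elim (y≢d (sym eq))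
... | no _    | yes x≡d | yes y≡c | _       = trans x≡d (trans (sym eq) (sym y≡c))
... | no _    | yes x≡d | no _    | yes y≡d = trans x≡d (sym y≡d)
... | no _    | yes _   | no y≢c  | no _    = ⊥-elim (y≢c (sym eq))
... | no _    | no x≢d  | yes _   | _       = ⊥-elim (x≢d eq)
... | no x≢c  | no _    | no _    | yes _   = ⊥-elim (x≢c eq)
... | no _    | no _    | no _    | no _    = eq

transposition-< : ∀ {c d x} → c < k → d < k → x < k → transposition c d x < k
transposition-< {c = c} {d} {x} c<k d<k x<k with x ≟ⁿ c | x ≟ⁿ d
... | yes _ | _     = d<k
... | no _  | yes _ = c<k
... | no _  | no _  = x<k

isColoring-transposition : ∀ (G : Hypergraph n) {c d} → c < k → d < k →
  IsColoring G k φ → IsColoring G k (transposition c d ∘ φ)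
isColoring-transposition G {c} {d} c<k d<k (bound , proper) =
  (λ x x∈V → transposition-< c<k d<k (bound x x∈V)) ,
  λ e e∈ → let x , y , x∈e , y∈e , φx≢φy = proper e e∈ in
    x , y , x∈e , y∈e , φx≢φy ∘ transposition-injective c d

recolor-vertex : ∀ (G : Hypergraph n) {c v} → Colorable G k → v ∈ V G → c < k →
  ∃[ ψ ] IsColoring G k ψ × ψ v ≡ c
recolor-vertex G (φ , col) v∈V c<k =
  _ , isColoring-transposition G (proj₁ col _ v∈V) c<k col , transposition-left (φ _) _

-- The first swap brings `a` to color `c`, the second brings `b` from its current color `q` to `d`.
-- The second swap does not disturb `a`, because `c` is neither `q` nor `d`.
recolor-pair : ∀ (G : Hypergraph n) {c d a b} → IsColoring G k φ → a ∈ V G → b ∈ V G →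
  φ a ≢ φ b → c < k → d < k → c ≢ d →
  ∃[ ψ ] IsColoring G k ψ × ψ a ≡ c × ψ b ≡ d
recolor-pair {φ = φ} G {c} {d} {a} {b} col a∈V b∈V φa≢φb c<k d<k c≢d =
  transposition q d ∘ φ′ ,
  isColoring-transposition G (proj₁ colφ′ b b∈V) d<k colφ′ ,
  trans (cong (transposition q d) φ′a≡c) (transposition-other c≢q c≢d) ,
  transposition-left q d
  where
  φ′ : Fin _ → ℕ
  φ′ = transposition (φ a) c ∘ φ

  q : ℕ
  q = φ′ b

  colφ′ : IsColoring G _ φ′
  colφ′ = isColoring-transposition G (proj₁ col a a∈V) c<k col

  φ′a≡c : φ′ a ≡ c
  φ′a≡c = transposition-left (φ a) c

  c≢q : c ≢ q
  c≢q c≡q = φa≢φb (transposition-injective (φ a) c (trans φ′a≡c c≡q))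

-- Gluing colorings

glue : Subset n → (Fin n → ℕ) → (Fin n → ℕ) → Fin n → ℕ
glue S φ ψ x with x ∈? S
... | yes _ = φ x
... | no _  = ψ x

glue-∈ : ∀ {S : Subset n} {x} → x ∈ S → glue S φ ψ x ≡ φ x
glue-∈ {S = S} {x} x∈S with x ∈? S
... | yes _  = refl
... | no x∉S = ⊥-elim (x∉S x∈S)

glue-∉ : ∀ {S : Subset n} {x} → x ∉ S → glue S φ ψ x ≡ ψ x
glue-∉ {S = S} {x} x∉S with x ∈? S
... | yes x∈S = ⊥-elim (x∉S x∈S)
... | no _    = refl

-- Critical hypergraphs

infixl 8 _─ᴱ_

_─ᴱ_ : Hypergraph n → Subset n → Hypergraph n
G ─ᴱ f = record
  { V     = V G
  ; E     = λ e → E G e × e ≢ f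
  ; E?    = λ e → E? G e ×-dec ¬? (e ≟ˢ f)
  ; E⊆V   = E⊆V G ∘ proj₁
  ; ∣E∣≥2 = ∣E∣≥2 G ∘ proj₁
  }

─ᴱ-⊏ : (G : Hypergraph n) → E G f → G ─ᴱ f ⊏ G
─ᴱ-⊏ G f∈ = ((λ x∈ → x∈) , proj₁) , λ (_ , _ , E⊆) → proj₂ (E⊆ f∈) refl

isColoring-─ᴱ⁻ : (G : Hypergraph n) → IsColoring (G ─ᴱ f) k φ → Bichromatic φ f → IsColoring G k φ
isColoring-─ᴱ⁻ {f = f} G (bound , proper) bi = bound , proper′
  where
  proper′ : ∀ e → E G e → Bichromatic _ e
  proper′ e e∈ with e ≟ˢ f
  ... | yes refl = bi
  ... | no e≢f   = proper e (e∈ , e≢f)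

-- One vertex `x` of `f` receives the fresh color `k`. Every edge through `x`, including `f`, has
-- another vertex, whose color is below `k`; edges avoiding `x` keep their colors.
colorable-─ᴱ : (G : Hypergraph n) → E G f → Colorable (G ─ᴱ f) k → Colorable G (suc k)
colorable-─ᴱ {f = f} {k = k} G f∈ (φ , bound , proper) = φ′ , bound′ , proper′
  where
  x : Fin _
  x = proj₁ (∣p∣≥2⇒distinct {p = f} (∣E∣≥2 G f∈))

  x∈f : x ∈ f
  x∈f = proj₁ (proj₂ (proj₂ (∣p∣≥2⇒distinct {p = f} (∣E∣≥2 G f∈))))

  φ′ : Fin _ → ℕ
  φ′ = updateAt φ x (const k)

  bound′ : ∀ y → y ∈ V G → φ′ y < suc k
  bound′ y y∈V with y ≟ᶠ x
  ... | yes refl = subst (_< suc k) (sym (updateAt-updates x φ)) (n<1+n k)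
  ... | no y≢x   = subst (_< suc k) (sym (updateAt-minimal y x φ y≢x)) (m<n⇒m<1+n (bound y y∈V))

  proper′ : ∀ e → E G e → Bichromatic φ′ e
  proper′ e e∈ with x ∈? e
  ... | yes x∈e =
    let y , y∈e , y≢x = ∣p∣≥2⇒other (∣E∣≥2 G e∈) x
    in y , x , y∈e , x∈e , λ φ′y≡φ′x → <⇒≢ (bound y (E⊆V G e∈ y∈e))
         (trans (sym (updateAt-minimal y x φ y≢x)) (trans φ′y≡φ′x (updateAt-updates x φ)))
  ... | no x∉e = bichromatic-resp
    (λ {y} y∈e → sym (updateAt-minimal y x φ λ { refl → x∉e y∈e }))
    (proper e (e∈ , λ { refl → x∉e x∈f }))

critical⇒¬colorable : (G : Hypergraph n) → Critical (suc k) G → ¬ Colorable G k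
critical⇒¬colorable G (χ≡ , _) c = <⇒≱ (≤-reflexive (sym χ≡)) (colorable⇒χ≤ G c)

critical⇒colorable-⊏ : (G : Hypergraph n) → Critical (suc k) G →
                       (H : Hypergraph n) → H ⊏ G → Colorable H k
critical⇒colorable-⊏ G (_ , χ<) H H⊏G with χ< H H⊏G
... | s≤s χ≤k = χ≤⇒colorable H χ≤k

-- If no edge contained `x`, a coloring of the hypergraph without `x` would extend to `x` by any
-- color, for instance 0.
critical⇒covered : (G : Hypergraph n) → 1 ≤ k → Critical (suc k) G →
                   ∀ {x} → x ∈ V G → ∃[ e ] ∂ G x e
critical⇒covered {k = k} G 1≤k crit {x} x∈V with anySubset? (λ e → E? G e ×-dec (x ∈? e))
... | yes covered = covered
... | no isolated = ⊥-elim (critical⇒¬colorable G crit (φ′ , bound′ , proper′))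
  where
  G-x⊏G : G [ V G - x ] ⊏ G
  G-x⊏G = (p─q⊆p (V G) ⁅ x ⁆ , proj₁) , λ (_ , V⊆ , _) → x∉p-x (V G) (V⊆ x∈V)

  col : Colorable (G [ V G - x ]) k
  col = critical⇒colorable-⊏ G crit (G [ V G - x ]) G-x⊏G

  φ₀ φ′ : Fin _ → ℕ
  φ₀  = proj₁ col
  φ′ = updateAt φ₀ x (const 0)

  bound′ : ∀ y → y ∈ V G → φ′ y < k
  bound′ y y∈V with y ≟ᶠ x
  ... | yes refl = subst (_< k) (sym (updateAt-updates x φ₀)) 1≤k
  ... | no y≢x   = subst (_< k) (sym (updateAt-minimal y x φ₀ y≢x))
                     (proj₁ (proj₂ col) y (x∈p∧x≢y⇒x∈p-y y∈V y≢x))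

  proper′ : ∀ e → E G e → Bichromatic φ′ e
  proper′ e e∈ = bichromatic-resp
    (λ {y} y∈e → sym (updateAt-minimal y x φ₀ (≢x y∈e)))
    (proj₂ (proj₂ col) e (e∈ , λ y∈e → x∈p∧x≢y⇒x∈p-y (E⊆V G e∈ y∈e) (≢x y∈e)))
    where
    ≢x : ∀ {y} → y ∈ e → y ≢ x
    ≢x y∈e refl = isolated (e , e∈ , y∈e)

-- A proper subhypergraph must miss an edge: one with all the edges also has all the vertices, since
-- each lies on an edge. Hence it lies below some `G ─ᴱ f`. The given edge yields the upper bound on
-- `χ G`, by one additional color.
edgeCritical⇒critical : (G : Hypergraph n) → ¬ Colorable G k → ∃ (E G) →
  (∀ {x} → x ∈ V G → ∃[ e ] ∂ G x e) →
  (∀ {e} → E G e → Colorable (G ─ᴱ e) k) →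
  Critical (suc k) G
edgeCritical⇒critical {k = k} G ¬col (e , e∈) covered col-─ᴱ =
  ≤-antisym (colorable⇒χ≤ G (colorable-─ᴱ G e∈ (col-─ᴱ e∈))) (≰⇒> (¬col ∘ χ≤⇒colorable G)) ,
  λ H H⊏G → s≤s (colorable⇒χ≤ H (col-⊏ H H⊏G))
  where
  col-⊏ : (H : Hypergraph _) → H ⊏ G → Colorable H k
  col-⊏ H (H⊑G , H≭G) with anySubset? (λ f → E? G f ×-dec ¬? (E? H f))
  ... | yes (f , f∈G , f∉H) =
    let φ , col = col-─ᴱ f∈G
    in φ , isColoring-⊑ {H = H} {G = G ─ᴱ f}
             (proj₁ H⊑G , λ f′∈H → proj₂ H⊑G f′∈H , λ { refl → f∉H f′∈H }) col
  ... | no none = ⊥-elim (H≭G (H⊑G , V⊆ , E⊆))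
    where
    E⊆ : ∀ {f} → E G f → E H f
    E⊆ {f} f∈G = decidable-stable (E? H f) λ f∉H → none (f , f∈G , f∉H)

    V⊆ : V G ⊆ V H
    V⊆ x∈V = let f , f∈G , x∈f = covered x∈V in E⊆V H (E⊆ f∈G) x∈f

-- An edge inside a pair must be the whole pair, so it suffices to separate `x` from the rest.
pair⇒colorable : (G : Hypergraph n) → ∣ e ∣ ≡ 2 → V G ⊆ e → Colorable G 2
pair⇒colorable {e = e} G ∣e∣≡2 V⊆e with ∣p∣≥2⇒distinct (≤-reflexive (sym ∣e∣≡2))
... | x , y , x∈e , y∈e , x≢y = θ , bound , proper
  where
  θ : Fin _ → ℕ
  θ = updateAt (const 0) x (const 1)

  θ-other : ∀ {z} → z ≢ x → θ z ≡ 0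
  θ-other {z} = updateAt-minimal z x (const 0)

  bound : ∀ z → z ∈ V G → θ z < 2
  bound z _ with z ≟ᶠ x
  ... | yes refl = subst (_< 2) (sym (updateAt-updates x (const 0))) (s≤s (s≤s z≤n))
  ... | no z≢x   = subst (_< 2) (sym (θ-other z≢x)) (s≤s z≤n)

  proper : ∀ f → E G f → Bichromatic θ f
  proper f f∈ with ∣p∣≥2⇒other (∣E∣≥2 G f∈) x | ∣p∣≥2⇒other (∣E∣≥2 G f∈) y
  ... | u , u∈f , u≢x | w , w∈f , w≢y
    with ∣p∣≡2⇒pair ∣e∣≡2 x∈e y∈e x≢y (V⊆e (E⊆V G f∈ w∈f))
  ... | inj₂ w≡y  = ⊥-elim (w≢y w≡y)
  ... | inj₁ refl = u , x , u∈f , w∈f , λ θu≡θx →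
    0≢1+n (trans (sym (θ-other u≢x)) (trans θu≡θx (updateAt-updates x (const 0))))

-- Otherwise two colors, hence `k`, would suffice. For `G₁` this gives a vertex outside `ẽ`.
critical⇒⊈pair : (G : Hypergraph n) → 2 ≤ k → Critical (suc k) G →
                 ∣ e ∣ ≡ 2 → ∃[ x ] x ∈ V G × x ∉ e
critical⇒⊈pair {e = e} G 2≤k crit ∣e∣≡2 with any? (λ x → (x ∈? V G) ×-dec ¬? (x ∈? e))
... | yes x,x∈V,x∉e = x,x∈V,x∉e
... | no none = ⊥-elim (critical⇒¬colorable G crit
      (colorable-mono {G = G} 2≤k (pair⇒colorable G ∣e∣≡2 λ {x} x∈V →
        decidable-stable (x ∈? e) λ x∉e → none (x , x∈V , x∉e))))

-- The splitting of two critical hypergraphs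

module Splitting
  (2≤k : 2 ≤ k) (G₁ G₂ : Hypergraph n) (disjoint : Disjoint G₁ G₂)
  (crit₁ : Critical (suc k) G₁) (crit₂ : Critical (suc k) G₂)
  {ẽ : Subset n} (ẽ∈E₁ : E G₁ ẽ) (∣ẽ∣≡2 : ∣ ẽ ∣ ≡ 2)
  {ṽ : Fin n} (ṽ∈V₂ : ṽ ∈ V G₂)
  {s : Subset n → Subset n} (adm : Admissible ẽ G₂ ṽ s)
  where

  open Admissible adm

  S : Hypergraph n
  S = splitting G₁ ẽ G₂ ṽ s disjoint ẽ∈E₁ adm

  -- The vertex set of `G₂′`, so that `S [ X₂ ]` is `G₂′`.
  X₂ : Subset n
  X₂ = (V G₂ - ṽ) ∪ ẽ

  ẽ⊆V₁ : ẽ ⊆ V G₁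
  ẽ⊆V₁ = E⊆V G₁ ẽ∈E₁

  V₂⇒∉V₁ : ∀ {x} → x ∈ V G₂ → x ∉ V G₁
  V₂⇒∉V₁ x∈V₂ x∈V₁ = disjoint (_ , x∈p∩q⁺ (x∈V₁ , x∈V₂))

  V₂-ṽ⊆V₂ : V G₂ - ṽ ⊆ V G₂
  V₂-ṽ⊆V₂ = p─q⊆p (V G₂) ⁅ ṽ ⁆

  V₁⊆VS : V G₁ ⊆ V S
  V₁⊆VS = p⊆p∪q (V G₂ - ṽ)

  V₂-ṽ⊆VS : V G₂ - ṽ ⊆ V S
  V₂-ṽ⊆VS = q⊆p∪q (V G₁) (V G₂ - ṽ)

  V₂-ṽ⊆X₂ : V G₂ - ṽ ⊆ X₂
  V₂-ṽ⊆X₂ = p⊆p∪q ẽ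

  ẽ⊆X₂ : ẽ ⊆ X₂
  ẽ⊆X₂ = q⊆p∪q (V G₂ - ṽ) ẽ

  X₂⊆VS : X₂ ⊆ V S
  X₂⊆VS x∈X₂ = [ V₂-ṽ⊆VS , V₁⊆VS ∘ ẽ⊆V₁ ]′ (x∈p∪q⁻ (V G₂ - ṽ) ẽ x∈X₂)

  splitEdge : Subset n → Subset n
  splitEdge e = (e - ṽ) ∪ s e

  E₂∖∂⇒⊆V₂-ṽ : E G₂ e → ¬ ∂ G₂ ṽ e → e ⊆ V G₂ - ṽ
  E₂∖∂⇒⊆V₂-ṽ e∈ e∉∂ x∈e = x∈p∧x≢y⇒x∈p-y (E⊆V G₂ e∈ x∈e) λ { refl → e∉∂ (e∈ , x∈e) }

  splitEdge⊆X₂ : ∂ G₂ ṽ e → splitEdge e ⊆ X₂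
  splitEdge⊆X₂ {e} e∈∂ x∈ with x∈p∪q⁻ (e - ṽ) (s e) x∈
  ... | inj₁ x∈e-ṽ = V₂-ṽ⊆X₂ (x∈p∧x≢y⇒x∈p-y
          (E⊆V G₂ (proj₁ e∈∂) (p─q⊆p e ⁅ ṽ ⁆ x∈e-ṽ)) (y∈p-x⇒y≢x e x∈e-ṽ))
  ... | inj₂ x∈se  = ẽ⊆X₂ (into e∈∂ x∈se)

  -- Identifying ẽ with ṽ turns S back into G₂; colorings that are constant on
  -- ẽ correspond under this identification.

  contract : (Fin n → ℕ) → ℕ → Fin n → ℕ
  contract φ c = updateAt φ ṽ (const c)

  contract-ṽ : ∀ {φ c} → contract φ c ṽ ≡ c
  contract-ṽ {φ} = updateAt-updates ṽ φ

  contract-≢ : ∀ {φ c x} → x ≢ ṽ → contract φ c x ≡ φ x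
  contract-≢ {φ} {x = x} = updateAt-minimal x ṽ φ

  bichromatic-contract⁺ : ∀ {c} → ∂ G₂ ṽ e → (∀ {x} → x ∈ ẽ → φ x ≡ c) →
    Bichromatic φ (splitEdge e) → Bichromatic (contract φ c) e
  bichromatic-contract⁺ {e} {φ} {c} e∈∂ φẽ≡c = bichromatic-map merge
    where
    merge : ∀ {x} → x ∈ splitEdge e → ∃[ y ] y ∈ e × φ x ≡ contract φ c y
    merge {x} x∈ with x∈p∪q⁻ (e - ṽ) (s e) x∈
    ... | inj₁ x∈e-ṽ = x , p─q⊆p e ⁅ ṽ ⁆ x∈e-ṽ , sym (contract-≢ (y∈p-x⇒y≢x e x∈e-ṽ))
    ... | inj₂ x∈se  = ṽ , proj₂ e∈∂ , trans (φẽ≡c (into e∈∂ x∈se)) (sym contract-ṽ)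

  bichromatic-contract⁻ : ∀ {c} → ∂ G₂ ṽ e → (∀ {x} → x ∈ ẽ → φ x ≡ c) →
    Bichromatic (contract φ c) e → Bichromatic φ (splitEdge e)
  bichromatic-contract⁻ {e} {φ} {c} e∈∂ φẽ≡c = bichromatic-map lift
    where
    lift : ∀ {x} → x ∈ e → ∃[ y ] y ∈ splitEdge e × contract φ c x ≡ φ y
    lift {x} x∈e with x ≟ᶠ ṽ
    ... | no x≢ṽ  = x , p⊆p∪q (s e) (x∈p∧x≢y⇒x∈p-y x∈e x≢ṽ) , contract-≢ x≢ṽ
    ... | yes refl =
      -- The vertex `ṽ` is gone; since `s e` is nonempty, some vertex of `ẽ` in the split edge
      -- carries its color `c`.
      let y , y∈se = nonempty e∈∂
      in y , q⊆p∪q (e - ṽ) (s e) y∈se , trans contract-ṽ (sym (φẽ≡c (into e∈∂ y∈se)))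

  isColoring-contract : ∀ {c} → IsColoring (S [ X₂ ]) k φ → (∀ {x} → x ∈ ẽ → φ x ≡ c) →
                        c < k → IsColoring G₂ k (contract φ c)
  isColoring-contract {φ} {c} (bound , proper) φẽ≡c c<k = bound₂ , proper₂
    where
    bound₂ : ∀ x → x ∈ V G₂ → contract φ c x < k
    bound₂ x x∈V₂ with x ≟ᶠ ṽ
    ... | yes refl = subst (_< k) (sym contract-ṽ) c<k
    ... | no x≢ṽ   = subst (_< k) (sym (contract-≢ x≢ṽ))
                       (bound x (V₂-ṽ⊆X₂ (x∈p∧x≢y⇒x∈p-y x∈V₂ x≢ṽ)))

    proper₂ : ∀ e → E G₂ e → Bichromatic (contract φ c) e
    proper₂ e e∈ with ṽ ∈? e
    ... | yes ṽ∈e = bichromatic-contract⁺ e∈∂ φẽ≡c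
      (proper (splitEdge e) (inj₂ (inj₂ (e , e∈∂ , refl)) , splitEdge⊆X₂ e∈∂))
      where e∈∂ = e∈ , ṽ∈e
    ... | no ṽ∉e = bichromatic-resp
      (λ x∈e → sym (contract-≢ λ { refl → ṽ∉e x∈e }))
      (proper e (inj₂ (inj₁ (e∈ , ṽ∉e ∘ proj₂)) , V₂-ṽ⊆X₂ ∘ E₂∖∂⇒⊆V₂-ṽ e∈ (ṽ∉e ∘ proj₂)))

  -- Contraction would give a `k`-coloring of `G₂`. Working on `S [ X₂ ]` rather than `S` lets this
  -- apply both to restrictions of colorings of `S` and to the coloring of `G₂′` given by
  -- assumption.
  X₂-¬monochromatic : ∀ {c} → IsColoring (S [ X₂ ]) k φ → (∀ {x} → x ∈ ẽ → φ x ≡ c) → ¬ c < k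
  X₂-¬monochromatic colφ φẽ≡c c<k =
    critical⇒¬colorable G₂ crit₂ (_ , isColoring-contract colφ φẽ≡c c<k)

  -- Otherwise `ẽ` could be put back, and `G₁` would be `k`-colorable.
  ẽ-monochromatic : IsColoring (G₁ ─ᴱ ẽ) k φ → ∀ {x y} → x ∈ ẽ → y ∈ ẽ → φ x ≡ φ y
  ẽ-monochromatic {φ} colφ {x} {y} x∈ẽ y∈ẽ with φ x ≟ⁿ φ y
  ... | yes φx≡φy = φx≡φy
  ... | no φx≢φy  = ⊥-elim (critical⇒¬colorable G₁ crit₁
          (φ , isColoring-─ᴱ⁻ G₁ colφ (x , y , x∈ẽ , y∈ẽ , φx≢φy)))

  -- A fixed end of `ẽ`, whose color represents that of `ẽ` whenever `ẽ` is monochromatic.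
  a : Fin n
  a = proj₁ (∣p∣≥2⇒distinct {p = ẽ} (∣E∣≥2 G₁ ẽ∈E₁))

  a∈ẽ : a ∈ ẽ
  a∈ẽ = proj₁ (proj₂ (proj₂ (∣p∣≥2⇒distinct {p = ẽ} (∣E∣≥2 G₁ ẽ∈E₁))))

  ¬colorable : ¬ Colorable S k
  ¬colorable (φ , colφ) = X₂-¬monochromatic
    (isColoring-⊑ {H = S [ X₂ ]} {G = S} (X₂⊆VS , proj₁) colφ)
    (λ x∈ẽ → ẽ-monochromatic (isColoring-⊑ {H = G₁ ─ᴱ ẽ} {G = S} (V₁⊆VS , inj₁) colφ) x∈ẽ a∈ẽ)
    (proj₁ colφ a (V₁⊆VS (ẽ⊆V₁ a∈ẽ)))

  covered : ∀ {x} → x ∈ V S → ∃[ e ] ∂ S x e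
  covered x∈ with x∈p∪q⁻ (V G₁) (V G₂ - ṽ) x∈
  ... | inj₁ x∈V₁ = cover₁ x∈V₁
    where
    cover₁ : ∀ {x} → x ∈ V G₁ → ∃[ e ] ∂ S x e
    cover₁ {x} x∈V₁ with critical⇒covered G₁ (≤-trans (s≤s z≤n) 2≤k) crit₁ x∈V₁
    ... | e , e∈ , x∈e with e ≟ˢ ẽ
    ...   | no e≢ẽ   = e , inj₁ (e∈ , e≢ẽ) , x∈e
    ...   | yes refl =
      -- The edge found is `ẽ`, which is absent from `S`. As the sets `s f` cover `ẽ`, some split
      -- edge takes over.
      let f , f∈∂ , x∈sf = covers x∈e
      in splitEdge f , inj₂ (inj₂ (f , f∈∂ , refl)) , q⊆p∪q (f - ṽ) (s f) x∈sf
  ... | inj₂ x∈V₂-ṽ = cover₂ (critical⇒covered G₂ (≤-trans (s≤s z≤n) 2≤k) crit₂ (V₂-ṽ⊆V₂ x∈V₂-ṽ))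
    where
    cover₂ : ∃ (∂ G₂ _) → ∃[ e ] ∂ S _ e
    cover₂ (e , e∈ , x∈e) with ṽ ∈? e
    ... | no ṽ∉e  = e , inj₂ (inj₁ (e∈ , ṽ∉e ∘ proj₂)) , x∈e
    ... | yes ṽ∈e = splitEdge e , inj₂ (inj₂ (e , (e∈ , ṽ∈e) , refl)) ,
                    p⊆p∪q (s e) (x∈p∧x≢y⇒x∈p-y x∈e (y∈p-x⇒y≢x (V G₂) x∈V₂-ṽ))

  -- Both ends of ẽ get different colors in G₁ ─ᴱ f because ẽ is still an
  -- edge, and in S [ X₂ ] because it cannot be contracted.

  colorable-─ᴱ₁ : Colorable (S [ X₂ ]) k → E G₁ f → f ≢ ẽ → Colorable (S ─ᴱ f) k
  colorable-─ᴱ₁ {f} (φ₂ , col₂) f∈ f≢ẽ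
    with critical⇒colorable-⊏ G₁ crit₁ (G₁ ─ᴱ f) (─ᴱ-⊏ G₁ f∈)
  ... | φ₁ , bound₁ , proper₁ with proper₁ ẽ (ẽ∈E₁ , f≢ẽ ∘ sym)
  ...   | a , b , a∈ẽ , b∈ẽ , φ₁a≢φ₁b = θ , bound , proper
    where
    a≢b : a ≢ b
    a≢b = φ₁a≢φ₁b ∘ cong φ₁

    pair : ∀ {x} → x ∈ ẽ → x ≡ a ⊎ x ≡ b
    pair = ∣p∣≡2⇒pair ∣ẽ∣≡2 a∈ẽ b∈ẽ a≢b

    -- As `ẽ` consists of `a` and `b` only, equal colors here would make all of `ẽ` monochromatic.
    φ₂a≢φ₂b : φ₂ a ≢ φ₂ b
    φ₂a≢φ₂b φ₂a≡φ₂b = X₂-¬monochromatic col₂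
      (λ x∈ẽ → [ cong φ₂ , (λ x≡b → trans (cong φ₂ x≡b) (sym φ₂a≡φ₂b)) ]′ (pair x∈ẽ))
      (proj₁ col₂ a (ẽ⊆X₂ a∈ẽ))

    recolored : ∃[ φ₂′ ] IsColoring (S [ X₂ ]) k φ₂′ × φ₂′ a ≡ φ₁ a × φ₂′ b ≡ φ₁ b
    recolored = recolor-pair (S [ X₂ ]) col₂ (ẽ⊆X₂ a∈ẽ) (ẽ⊆X₂ b∈ẽ) φ₂a≢φ₂b
      (bound₁ a (ẽ⊆V₁ a∈ẽ)) (bound₁ b (ẽ⊆V₁ b∈ẽ)) φ₁a≢φ₁b

    φ₂′ θ : Fin n → ℕ
    φ₂′ = proj₁ recolored
    θ = glue (V G₁) φ₁ φ₂′

    φ₁≡φ₂′ : ∀ {x} → x ∈ ẽ → φ₁ x ≡ φ₂′ x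
    φ₁≡φ₂′ x∈ẽ with pair x∈ẽ
    ... | inj₁ refl = sym (proj₁ (proj₂ (proj₂ recolored)))
    ... | inj₂ refl = sym (proj₂ (proj₂ (proj₂ recolored)))

    -- `V G₁` and `X₂` overlap only in `ẽ`, where the recoloring made `φ₁` and `φ₂′` agree.
    φ₂′≡θ : ∀ x → x ∈ X₂ → φ₂′ x ≡ θ x
    φ₂′≡θ x x∈X₂ with x∈p∪q⁻ (V G₂ - ṽ) ẽ x∈X₂
    ... | inj₁ x∈V₂-ṽ = sym (glue-∉ (V₂⇒∉V₁ (V₂-ṽ⊆V₂ x∈V₂-ṽ)))
    ... | inj₂ x∈ẽ    = sym (trans (glue-∈ (ẽ⊆V₁ x∈ẽ)) (φ₁≡φ₂′ x∈ẽ))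

    colored₁ : IsColoring (G₁ ─ᴱ f) k θ
    colored₁ = isColoring-resp (G₁ ─ᴱ f) (λ _ x∈ → sym (glue-∈ x∈)) (bound₁ , proper₁)

    colored₂ : IsColoring (S [ X₂ ]) k θ
    colored₂ = isColoring-resp (S [ X₂ ]) φ₂′≡θ (proj₁ (proj₂ recolored))

    bound : ∀ x → x ∈ V S → θ x < k
    bound x x∈ = [ proj₁ colored₁ x , proj₁ colored₂ x ∘ V₂-ṽ⊆X₂ ]′
      (x∈p∪q⁻ (V G₁) (V G₂ - ṽ) x∈)

    proper : ∀ e → E (S ─ᴱ f) e → Bichromatic θ e
    proper e (inj₁ (e∈ , _) , e≢f) = proj₂ colored₁ e (e∈ , e≢f)
    proper e (e∈@(inj₂ (inj₁ (e∈₂ , e∉∂))) , _) =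
      proj₂ colored₂ e (e∈ , V₂-ṽ⊆X₂ ∘ E₂∖∂⇒⊆V₂-ṽ e∈₂ e∉∂)
    proper _ (e∈@(inj₂ (inj₂ (_ , e∈∂ , refl))) , _) =
      proj₂ colored₂ _ (e∈ , splitEdge⊆X₂ e∈∂)

  -- f′ is the edge of S that f becomes (f itself or splitEdge f); the two
  -- hypotheses say that no other edge of G₂ becomes f′.

  colorable-─ᴱ₂ : ∀ {f′} → E G₂ f → (∀ {e} → E G₂ e → ¬ ∂ G₂ ṽ e → e ≢ f′ → e ≢ f) →
    (∀ {e} → ∂ G₂ ṽ e → splitEdge e ≢ f′ → e ≢ f) → Colorable (S ─ᴱ f′) k
  colorable-─ᴱ₂ {f} {f′} f∈ unsplit≢ split≢
    with critical⇒colorable-⊏ G₁ crit₁ (G₁ ─ᴱ ẽ) (─ᴱ-⊏ G₁ ẽ∈E₁)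
  ... | φ₁ , col₁
    -- The color of `ṽ` is adjusted to the common color that `φ₁` gives to `ẽ`.
    with recolor-vertex (G₂ ─ᴱ f) (critical⇒colorable-⊏ G₂ crit₂ (G₂ ─ᴱ f) (─ᴱ-⊏ G₂ f∈))
           ṽ∈V₂ (proj₁ col₁ a (ẽ⊆V₁ a∈ẽ))
  ...   | φ₂ , col₂ , φ₂ṽ≡c = θ , bound , proper
    where
    c : ℕ
    c = φ₁ a

    θ : Fin n → ℕ
    θ = glue (V G₁) φ₁ φ₂

    -- On `G₂` the coloring `φ₂` is the contraction of the glued coloring `θ`, so its bichromatic
    -- edges can be lifted back to `S`.
    φ₂≡contract : ∀ x → x ∈ V G₂ → φ₂ x ≡ contract θ c x
    φ₂≡contract x x∈V₂ with x ≟ᶠ ṽ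
    ... | yes refl = trans φ₂ṽ≡c (sym contract-ṽ)
    ... | no x≢ṽ   = sym (trans (contract-≢ x≢ṽ) (glue-∉ (V₂⇒∉V₁ x∈V₂)))

    θẽ≡c : ∀ {x} → x ∈ ẽ → θ x ≡ c
    θẽ≡c x∈ẽ = trans (glue-∈ (ẽ⊆V₁ x∈ẽ)) (ẽ-monochromatic col₁ x∈ẽ a∈ẽ)

    colored₁ : IsColoring (G₁ ─ᴱ ẽ) k θ
    colored₁ = isColoring-resp (G₁ ─ᴱ ẽ) (λ _ x∈ → sym (glue-∈ x∈)) col₁

    colored₂ : IsColoring (G₂ ─ᴱ f) k (contract θ c)
    colored₂ = isColoring-resp (G₂ ─ᴱ f) φ₂≡contract col₂

    bound : ∀ x → x ∈ V S → θ x < k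
    bound x x∈ with x∈p∪q⁻ (V G₁) (V G₂ - ṽ) x∈
    ... | inj₁ x∈V₁   = proj₁ colored₁ x x∈V₁
    ... | inj₂ x∈V₂-ṽ = subst (_< k) (contract-≢ (y∈p-x⇒y≢x (V G₂) x∈V₂-ṽ))
                          (proj₁ colored₂ x (V₂-ṽ⊆V₂ x∈V₂-ṽ))

    proper : ∀ e → E (S ─ᴱ f′) e → Bichromatic θ e
    proper e (inj₁ e∈ , _) = proj₂ colored₁ e e∈
    proper e (inj₂ (inj₁ (e∈ , e∉∂)) , e≢f′) = bichromatic-resp
      (λ x∈e → contract-≢ λ { refl → e∉∂ (e∈ , x∈e) })
      (proj₂ colored₂ e (e∈ , unsplit≢ e∈ e∉∂ e≢f′))
    proper _ (inj₂ (inj₂ (e , e∈∂ , refl)) , e≢f′) = bichromatic-contract⁻ e∈∂ θẽ≡c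
      (proj₂ colored₂ e (proj₁ e∈∂ , split≢ e∈∂ e≢f′))

  critical : Colorable (S [ X₂ ]) k → Critical (suc k) S
  critical col₂ = edgeCritical⇒critical S ¬colorable
    (let e , e∈ , _ = covered (V₁⊆VS (ẽ⊆V₁ a∈ẽ)) in e , e∈) covered
    λ where
      (inj₁ (f∈ , f≢ẽ)) → colorable-─ᴱ₁ col₂ f∈ f≢ẽ
      (inj₂ (inj₁ (f∈ , f∉∂))) →
        -- Here `f` avoids `ṽ`, so it differs from every edge that is split.
        colorable-─ᴱ₂ f∈ (λ _ _ e≢f → e≢f) (λ { e∈∂ _ refl → f∉∂ e∈∂ })
      (inj₂ (inj₂ (f , f∈∂ , refl))) →
        -- Here `f` contains `ṽ`, so it differs from every edge kept unchanged; a different split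
        -- edge comes from a different edge.
        colorable-─ᴱ₂ (proj₁ f∈∂) (λ { _ e∉∂ _ refl → e∉∂ f∈∂ })
          (λ { _ split≢ refl → split≢ refl })

  -- The separating vertex set

  separating : SeparatingVertexSet S ẽ
  separating =
    -- The two sides are `V G₁` and `X₂`: edges from `G₁` lie in the first, edges from `G₂`, split
    -- or not, in the second.
    V₁⊆VS ∘ ẽ⊆V₁ , V G₁ , X₂ , V₁⊆VS , X₂⊆VS ,
    ((VS⊆ , E⊆) , (⊆VS , [ proj₁ , proj₁ ]′)) ,
    ⊆-antisym ∩⊆ẽ (λ x∈ẽ → x∈p∩q⁺ (ẽ⊆V₁ x∈ẽ , ẽ⊆X₂ x∈ẽ)) ,
    p⊂q⇒∣p∣<∣q∣ (ẽ⊆V₁ , critical⇒⊈pair G₁ 2≤k crit₁ ∣ẽ∣≡2) ,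
    p⊂q⇒∣p∣<∣q∣ (ẽ⊆X₂ , X₂∖ẽ)
    where
    VS⊆ : V S ⊆ V G₁ ∪ X₂
    VS⊆ x∈ = x∈p∪q⁺ ([ inj₁ , inj₂ ∘ V₂-ṽ⊆X₂ ]′ (x∈p∪q⁻ (V G₁) (V G₂ - ṽ) x∈))

    ⊆VS : V G₁ ∪ X₂ ⊆ V S
    ⊆VS x∈ = [ V₁⊆VS , X₂⊆VS ]′ (x∈p∪q⁻ (V G₁) X₂ x∈)

    E⊆ : ∀ {e} → E S e → E (S [ V G₁ ] ⊔ᴴ S [ X₂ ]) e
    E⊆ e∈@(inj₁ (e∈₁ , _)) = inj₁ (e∈ , E⊆V G₁ e∈₁)
    E⊆ e∈@(inj₂ (inj₁ (e∈₂ , e∉∂))) = inj₂ (e∈ , V₂-ṽ⊆X₂ ∘ E₂∖∂⇒⊆V₂-ṽ e∈₂ e∉∂)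
    E⊆ e∈@(inj₂ (inj₂ (_ , e∈∂ , refl))) = inj₂ (e∈ , splitEdge⊆X₂ e∈∂)

    ∩⊆ẽ : V G₁ ∩ X₂ ⊆ ẽ
    ∩⊆ẽ x∈ with x∈p∩q⁻ (V G₁) X₂ x∈
    ... | x∈V₁ , x∈X₂ with x∈p∪q⁻ (V G₂ - ṽ) ẽ x∈X₂
    ...   | inj₁ x∈V₂-ṽ = ⊥-elim (V₂⇒∉V₁ (V₂-ṽ⊆V₂ x∈V₂-ṽ) x∈V₁)
    ...   | inj₂ x∈ẽ    = x∈ẽ

    X₂∖ẽ : ∃[ x ] x ∈ X₂ × x ∉ ẽ
    X₂∖ẽ =
      -- An edge at `ṽ` has a second vertex, which is in `V G₂` and therefore outside `ẽ` by
      -- disjointness.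
      let e , (e∈ , _) , _ = covers a∈ẽ
          x , x∈e , x≢ṽ = ∣p∣≥2⇒other (∣E∣≥2 G₂ e∈) ṽ
          x∈V₂ = E⊆V G₂ e∈ x∈e
      in x , V₂-ṽ⊆X₂ (x∈p∧x≢y⇒x∈p-y x∈V₂ x≢ṽ) , V₂⇒∉V₁ x∈V₂ ∘ ẽ⊆V₁

theorem16 :
  ∀ {n : ℕ} (k : ℕ) → 2 ≤ k →
  (G₁ G₂ : Hypergraph n) (disjoint : Disjoint G₁ G₂) →
  Critical (suc k) G₁ → Critical (suc k) G₂ →
  (ẽ : Subset n) (ẽ∈E₁ : E G₁ ẽ) → ∣ ẽ ∣ ≡ 2 →
  (ṽ : Fin n) → ṽ ∈ V G₂ →
  (s : Subset n → Subset n) (adm : Admissible ẽ G₂ ṽ s) →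
  let G   = splitting G₁ ẽ G₂ ṽ s disjoint ẽ∈E₁ adm
      G₂′ = G [ (V G₂ - ṽ) ∪ ẽ ]
  in χ G₂′ ≤ k →
     Critical (suc k) G × SeparatingVertexSet G ẽ × ∣ ẽ ∣ ≡ 2
theorem16 k 2≤k G₁ G₂ disjoint crit₁ crit₂ ẽ ẽ∈E₁ ∣ẽ∣≡2 ṽ ṽ∈V₂ s adm χG₂′≤k =
  critical (χ≤⇒colorable (S [ X₂ ]) χG₂′≤k) , separating , ∣ẽ∣≡2
  where open Splitting 2≤k G₁ G₂ disjoint crit₁ crit₂ ẽ∈E₁ ∣ẽ∣≡2 ṽ∈V₂ adm
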